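{- For any $m,n\in\mathbb{N}$ and any zero-set $\mathcal{Z}\subseteq R_{m,n}$, we have $\mu(\mathcal{Z})\le 2mn+5$.
   Context: $\mathbb{Z}_+=\{0,1,2,\dots\}$, $\mathbb{N}=\{1,2,\dots\}$. For $a,b\in\mathbb{N}$, $R_{a,b}=([0,a-1]\times[0,b-1])\cap\mathbb{Z}_+^2$. A zero-set is a union $\mathcal{Z}=\bigcup_{(a,b)\in\mathcal{I}}R_{a,b}$ over a finite set $\mathcal{I}\subseteq\mathbb{N}^2$ (possibly $\mathcal{Z}=\emptyset$). For $x\in\mathbb{Z}_+^2$, $L^h(x)$ and $L^v(x)$ denote the horizontal and vertical lines through $x$ in $\mathbb{Z}_+^2$. For $A\subseteq\mathbb{Z}_+^2$, $\mathtt{row}(x,A)=|L^h(x)\cap A|$ and $\mathtt{col}(x,A)=|L^v(x)\cap A|$. The neighborhood growth transformation is $\mathcal{T}(A)=A\cup\{x\notin A:(\mathtt{row}(x,A),\mathtt{col}(x,A))\notin\mathcal{Z}\}$. A set $A$ spans if $\bigcup_{t\ge0}\mathcal{T}^t(A)=\mathbb{Z}_+^2$. Let $\mathcal{A}(\mathcal{Z})$ be the collection of all finite spanning sets; for $A\in\mathcal{A}(\mathcal{Z})$ the spanning time is $\tau(\mathcal{Z},A)=\min\{t\in\mathbb{N}:\mathcal{T}^t(A)=\mathbb{Z}_+^2\}$ (which is finite), and $\mu(\mathcal{Z})=\sup\{\tau(\mathcal{Z},A):A\in\mathcal{A}(\mathcal{Z})\}$. -}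

module Defs where

open import Data.Nat using (ℕ; zero; suc; _<_; _≤_; _+_; _*_)
open import Data.Product using (_×_; _,_; proj₁; proj₂; ∃; Σ)
open import Data.Sum using (_⊎_)
open import Data.List using (List; length)
open import Data.List.Relation.Unary.All using (All)
open import Data.List.Relation.Unary.Any using (Any)
open import Data.List.Relation.Unary.Unique.Propositional using (Unique)
open import Data.List.Membership.Propositional using (_∈_)
open import Relation.Binary.PropositionalEquality using (_≡_)
open import Relation.Nullary using (¬_)

-- Points of ℤ₊² : (i , j); i is the horizontal coordinate, j the vertical one.
Point : Set
Point = ℕ × ℕ

Subset : Set₁
Subset = Point → Set

-- A zero-set is given by a finite index list ℐ ⊆ ℕ² (entries positive);
-- 𝒵 = ⋃_{(a,b) ∈ ℐ} R_{a,b}, with R_{a,b} = [0,a-1]×[0,b-1].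
Index : Set
Index = List (ℕ × ℕ)

Positive : Index → Set
Positive I = All (λ ab → 1 ≤ proj₁ ab × 1 ≤ proj₂ ab) I

R : ℕ → ℕ → Subset
R a b (r , c) = r < a × c < b

Zset : Index → Subset
Zset I p = Any (λ ab → R (proj₁ ab) (proj₂ ab) p) I

_⊆_ : Subset → Subset → Set
S ⊆ T = ∀ p → S p → T p

Finite : Subset → Set
Finite A = ∃ λ (xs : List Point) → ∀ p → A p → p ∈ xs

-- "row(x,A) ≥ k": the horizontal line through x contains at least k points of A
-- (expressed without counting, since the line may meet A in infinitely many points).
RowAtLeast : Subset → Point → ℕ → Set
RowAtLeast A (i , j) k =
  ∃ λ (is : List ℕ) → length is ≡ k × Unique is × All (λ i' → A (i' , j)) is

ColAtLeast : Subset → Point → ℕ → Set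
ColAtLeast A (i , j) k =
  ∃ λ (js : List ℕ) → length js ≡ k × Unique js × All (λ j' → A (i , j')) js

-- (row(x,A), col(x,A)) ∉ 𝒵 : for every (a,b) ∈ ℐ, not (row < a and col < b),
-- i.e. row ≥ a or col ≥ b  (counts possibly infinite).
OutsideZ : Index → Subset → Point → Set
OutsideZ I A x = All (λ ab → RowAtLeast A x (proj₁ ab) ⊎ ColAtLeast A x (proj₂ ab)) I

T : Index → Subset → Subset
T I A x = A x ⊎ (¬ A x × OutsideZ I A x)

Tpow : Index → ℕ → Subset → Subset
Tpow I zero A = A
Tpow I (suc t) A = T I (Tpow I t A)

Full : Subset → Set
Full S = ∀ x → S x

Spans : Index → Subset → Set
Spans I A = ∀ x → ∃ λ t → Tpow I t A x

{-# OPTIONS --safe #-}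

-- Let aᵣ be the number of rows with at least r occupied points and f the number
-- of full rows; define b_c and g in the same way for columns.  The potential
--   Σ_{1≤r≤m} min(aᵣ, n-1) + Σ_{1≤c≤n} min(b_c, m-1) + min(f, n) + min(g, m)
-- is at most 2mn, and it increases at every step, except within three steps of
-- the end.  Indeed, let x be a newly occupied point, with row count r and column
-- count c just before.  If r ≥ m or c ≥ n, its whole row or column becomes full.
-- Otherwise a_{r+1} and b_{c+1} both increase, which can only go unnoticed if
-- they were at least n-1 and m-1.  Together with the lines through x this gives
-- n rows with at least r points and m columns with at least c points; they cross
-- in points that are occupied one step later, then the n rows are full, and then
-- the plane is.
--
-- Each Tpow I t A is decidable because the proof of Spans records when a point
-- was added, so the conclusion is stable and the argument may be classical.
module Submission where

open import Defs
open import Data.Nat using (ℕ; zero; suc; _≤_; _<_; _+_; _*_; z≤n; s≤s; _≤′_; ≤′-refl; ≤′-step)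
open import Data.Nat.Properties
open import Data.Nat.ListAction using (sum)
open import Data.Nat.ListAction.Properties using (sum-++)
open import Data.Nat.Tactic.RingSolver using (solve-∀)
open import Data.Product using (_×_; ∃; _,_; proj₁; proj₂)
open import Data.Sum using (_⊎_; inj₁; inj₂; [_,_]′)
open import Data.List using (List; []; _∷_; _++_; map; take; length; applyUpTo)
open import Data.List.Properties using (length-take; map-++)
open import Data.List.Relation.Unary.All as All using (All; []; _∷_)
import Data.List.Relation.Unary.All.Properties as All
open import Data.List.Relation.Unary.Any using (Any; here; there)
import Data.List.Relation.Unary.Any.Properties as Any
open import Data.List.Relation.Unary.AllPairs using ([]; _∷_)
open import Data.List.Relation.Unary.Unique.Propositional using (Unique)
import Data.List.Relation.Unary.Unique.Propositional.Properties as Unique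
open import Function using (_∘_; id)
open import Relation.Binary.PropositionalEquality using (_≡_; refl; sym; trans; cong; cong₂; subst)
open import Relation.Nullary using (¬_; Dec; yes; no; contradiction)
open import Relation.Nullary.Decidable using (¬¬-excluded-middle; decidable-stable)

-- Counting indices on a line

private variable
  P Q : ℕ → Set
  k l : ℕ

-- RowAtLeast A (i , j) and ColAtLeast A (i , j) unfold to
-- AtLeast (row A j) and AtLeast (col A i).
AtLeast : (ℕ → Set) → ℕ → Set
AtLeast P k = ∃ λ (is : List ℕ) → length is ≡ k × Unique is × All P is

row col : Subset → ℕ → ℕ → Set
row S j i = S (i , j)
col S i j = S (i , j)

AtLeast-zero : AtLeast P 0
AtLeast-zero = [] , refl , [] , []

AtLeast-map : (∀ {i} → P i → Q i) → AtLeast P k → AtLeast Q k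
AtLeast-map f (is , len , uniq , all) = is , len , uniq , All.map f all

AtLeast-≤ : l ≤ k → AtLeast P k → AtLeast P l
AtLeast-≤ {l} l≤k (is , refl , uniq , all) =
  take l is , trans (length-take l is) (m≤n⇒m⊓n≡m l≤k) , Unique.take⁺ l uniq , All.take⁺ l all

-- Having two predicates serves both a later time and a lowered threshold; `¬ P y` keeps `y` off the
-- list.
AtLeast-suc : ∀ {y} → (∀ {i} → P i → Q i) → ¬ P y → Q y → AtLeast P k → AtLeast Q (suc k)
AtLeast-suc {P = P} {y = y} f ¬Py Qy (is , refl , uniq , all) =
  y ∷ is , refl , All.map (λ Pi y≡i → ¬Py (subst P (sym y≡i) Pi)) all ∷ uniq , Qy ∷ All.map f all

-- `P` is arbitrary, so each threshold is decided only under double negation.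
exactCount : (P : ℕ → Set) (k : ℕ) →
  ¬ ¬ (AtLeast P k ⊎ ∃ λ l → l < k × AtLeast P l × ¬ AtLeast P (suc l))
exactCount P zero    ¬r = ¬r (inj₁ AtLeast-zero)
exactCount P (suc k) ¬r = exactCount P k λ where
  (inj₂ (l , l<k , rest)) → ¬r (inj₂ (l , m<n⇒m<1+n l<k , rest))
  (inj₁ P≥k) → ¬¬-excluded-middle λ where
    (yes P≥1+k) → ¬r (inj₁ P≥1+k)
    (no  P≱1+k) → ¬r (inj₂ (k , n<1+n k , P≥k , P≱1+k))

-- Truncated counters and their total

record Counter : Set₁ where
  field
    cap     : ℕ
    Counted : ℕ → ℕ → Set
    grow    : ∀ {t i} → Counted t i → Counted (suc t) i
open Counter

totalCap : List Counter → ℕ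
totalCap = sum ∘ map cap

-- A lower bound for the sum of the counters at time t, each truncated at its cap.
data Tally (t : ℕ) : List Counter → ℕ → Set₁ where
  []      : Tally t [] 0
  counter : ∀ {c cs k s} → k ≤ cap c → AtLeast (Counted c t) k → Tally t cs s → Tally t (c ∷ cs) (k + s)

Saturated Advances : ℕ → Counter → Set
Saturated t c = AtLeast (Counted c t) (cap c)
Advances t c = ¬ Saturated t c × ∃ λ i → ¬ Counted c t i × Counted c (suc t) i

tally-zero : ∀ t cs → Tally t cs 0
tally-zero t []       = []
tally-zero t (c ∷ cs) = counter z≤n AtLeast-zero (tally-zero t cs)

tally-≤ : ∀ {t cs s} → Tally t cs s → s ≤ totalCap cs
tally-≤ []                = z≤n
tally-≤ (counter k≤ _ ts) = +-mono-≤ k≤ (tally-≤ ts)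

tally-keep : ∀ {t cs s} → Tally t cs s → Tally (suc t) cs s
tally-keep []                         = []
tally-keep (counter {c = c} k≤ P≥ ts) = counter k≤ (AtLeast-map (grow c) P≥) (tally-keep ts)

tally-advance : ∀ {t cs s} → Tally t cs s → Any (Advances t) cs → Tally (suc t) cs (suc s)
tally-advance (counter {c = c} k≤ P≥ ts) (here (unsat , i , ¬Pi , Pi)) =
  counter (≤∧≢⇒< k≤ (λ { refl → unsat P≥ })) (AtLeast-suc (grow c) ¬Pi Pi P≥) (tally-keep ts)
tally-advance (counter {c = c} {k = k} {s = s} k≤ P≥ ts) (there adv) =
  subst (Tally _ _) (+-suc k s) (counter k≤ (AtLeast-map (grow c) P≥) (tally-advance ts adv))

-- An advance at every time up to the total cap would push the tally one above that cap.
someIdle : ∀ cs → ¬ (∀ t → t ≤ totalCap cs → ¬ ¬ Any (Advances t) cs)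
someIdle cs advances = reach (suc (totalCap cs)) ≤-refl (λ ts → 1+n≰n (tally-≤ ts))
  where
  reach : ∀ t → t ≤ suc (totalCap cs) → ¬ ¬ Tally t cs t
  reach zero    _         ¬r = ¬r (tally-zero 0 cs)
  reach (suc t) (s≤s t≤) ¬r =
    reach t (m≤n⇒m≤1+n t≤) λ ts → advances t t≤ λ adv → ¬r (tally-advance ts adv)

totalCap-applyUpTo : ∀ (f : ℕ → Counter) d → (∀ i → cap (f i) ≡ d) → ∀ k → totalCap (applyUpTo f k) ≡ k * d
totalCap-applyUpTo f d cap≡ zero    = refl
totalCap-applyUpTo f d cap≡ (suc k) = cong₂ _+_ (cap≡ 0) (totalCap-applyUpTo (f ∘ suc) d (cap≡ ∘ suc) k)

totalCap-++ : ∀ cs ds → totalCap (cs ++ ds) ≡ totalCap cs + totalCap ds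
totalCap-++ cs ds = trans (cong sum (map-++ cap cs ds)) (sum-++ (map cap cs) (map cap ds))

-- Zero-sets and iterates

index-bounds : ∀ {m n} (I : Index) → Positive I → Zset I ⊆ R m n →
  All (λ ab → proj₁ ab ≤ m × proj₂ ab ≤ n) I
index-bounds []                     []                     Z⊆R = []
index-bounds ((suc a , suc b) ∷ I) ((s≤s _ , s≤s _) ∷ pos) Z⊆R =
  -- The top corner `(a , b)` of the first rectangle must lie in `R m n`.
  Z⊆R (a , b) (here (≤-refl , ≤-refl)) ∷ index-bounds I pos (λ p → Z⊆R p ∘ there)

Tpow-≤ : ∀ I A {s t} → s ≤ t → Tpow I s A ⊆ Tpow I t A
Tpow-≤ I A {s} s≤t x = go (≤⇒≤′ s≤t)
  where
  go : ∀ {t} → s ≤′ t → Tpow I s A x → Tpow I t A x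
  go ≤′-refl       = id
  go (≤′-step s≤t) = inj₁ ∘ go s≤t

Tpow? : ∀ I A → Spans I A → ∀ t x → Dec (Tpow I t A x)
Tpow? I A spans t x = go (proj₁ (spans x)) (proj₂ (spans x))
  where
  go : ∀ s → Tpow I s A x → Dec (Tpow I t A x)
  go zero    Ax        = yes (Tpow-≤ I A (z≤n {t}) x Ax)
  go (suc s) (inj₁ Ts) = go s Ts
  go (suc s) (inj₂ (¬Ts , out)) with ≤-<-connex t s
  ... | inj₁ t≤s = no (¬Ts ∘ Tpow-≤ I A t≤s x)
  ... | inj₂ s<t = yes (Tpow-≤ I A s<t x (inj₂ (¬Ts , out)))

-- Growth of a spanning set

module Spanning {m n : ℕ} (I : Index)
  (bounds : All (λ ab → proj₁ ab ≤ suc m × proj₂ ab ≤ suc n) I)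
  (A : Subset) (spans : Spans I A) where

  U : ℕ → Subset
  U t = Tpow I t A

  occupy : ∀ t x → OutsideZ I (U t) x → U (suc t) x
  occupy t x out with Tpow? I A spans t x
  ... | yes Ux = inj₁ Ux
  ... | no ¬Ux = inj₂ (¬Ux , out)

  longRow : ∀ t j → AtLeast (row (U t) j) (suc m) → ∀ i → U (suc t) (i , j)
  longRow t j long i = occupy t (i , j) (All.map (λ (a≤ , _) → inj₁ (AtLeast-≤ a≤ long)) bounds)

  longCol : ∀ t i → AtLeast (col (U t) i) (suc n) → ∀ j → U (suc t) (i , j)
  longCol t i long j = occupy t (i , j) (All.map (λ (_ , b≤) → inj₂ (AtLeast-≤ b≤ long)) bounds)

  fullRows⇒full : ∀ t → AtLeast (λ j → ∀ i → U t (i , j)) (suc n) → Full (U (suc t))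
  fullRows⇒full t rows (i , j) = longCol t i (AtLeast-map (λ full → full i) rows) j

  fullCols⇒full : ∀ t → AtLeast (λ i → ∀ j → U t (i , j)) (suc m) → Full (U (suc t))
  fullCols⇒full t cols (i , j) = longRow t j (AtLeast-map (λ full → full j) cols) i

  rectangle⇒full : ∀ t → AtLeast P (suc n) → AtLeast Q (suc m) →
    (∀ {i j} → P j → Q i → U t (i , j)) → Full (U (2 + t))
  rectangle⇒full t rows cols occupied =
    fullRows⇒full (suc t) (AtLeast-map (λ Pj → longRow t _ (AtLeast-map (occupied Pj) cols)) rows)

  crossing : ∀ t x {r c} → OutsideZ I (U t) x →
    ¬ RowAtLeast (U t) x (suc r) → ¬ ColAtLeast (U t) x (suc c) →
    ∀ {i j} → AtLeast (row (U t) j) r → AtLeast (col (U t) i) c → U (suc t) (i , j)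
  crossing t x {r} {c} out ¬row ¬col {i} {j} row≥ col≥ = occupy t (i , j) (All.map transfer out)
    where
    transfer : ∀ {ab} → RowAtLeast (U t) x (proj₁ ab) ⊎ ColAtLeast (U t) x (proj₂ ab) →
      RowAtLeast (U t) (i , j) (proj₁ ab) ⊎ ColAtLeast (U t) (i , j) (proj₂ ab)
    transfer (inj₁ x≥a) = inj₁ (AtLeast-≤ (≮⇒≥ λ r<a → ¬row (AtLeast-≤ r<a x≥a)) row≥)
    transfer (inj₂ x≥b) = inj₂ (AtLeast-≤ (≮⇒≥ λ c<b → ¬col (AtLeast-≤ c<b x≥b)) col≥)

  -- Counts are monotone in the set, so a stationary set absorbs every iterate, and the iterates
  -- exhaust the plane.
  stationary⇒full : ∀ t → U (suc t) ⊆ U t → Full (U t)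
  stationary⇒full t stop x = back (proj₁ (spans x)) x (proj₂ (spans x))
    where
    back : ∀ s → U s ⊆ U t
    back zero    x Ux               = Tpow-≤ I A (z≤n {t}) x Ux
    back (suc s) x (inj₁ Ux)        = back s x Ux
    back (suc s) x (inj₂ (_ , out)) = stop x (occupy t x (All.map
      [ inj₁ ∘ AtLeast-map (back s _) , inj₂ ∘ AtLeast-map (back s _) ]′ out))

  newPoint : ∀ t → ¬ Full (U t) → ¬ ¬ ∃ λ x → ¬ U t x × OutsideZ I (U t) x
  newPoint t ¬full none = ¬full (stationary⇒full t λ where
    x (inj₁ Ux)  → Ux
    x (inj₂ new) → contradiction (x , new) none)

  -- Index `r` stands for threshold `suc r`. The caps are one below the sides `suc n` and `suc m`,
  -- since the line through a new point supplies the missing one.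
  longRows longCols : ℕ → Counter
  longRows r = record
    { cap = n ; Counted = λ t j → AtLeast (row (U t) j) (suc r) ; grow = AtLeast-map inj₁ }
  longCols c = record
    { cap = m ; Counted = λ t i → AtLeast (col (U t) i) (suc c) ; grow = AtLeast-map inj₁ }

  fullRows fullCols : Counter
  fullRows = record
    { cap = suc n ; Counted = λ t j → ∀ i → U t (i , j) ; grow = λ full i → inj₁ (full i) }
  fullCols = record
    { cap = suc m ; Counted = λ t i → ∀ j → U t (i , j) ; grow = λ full j → inj₁ (full j) }

  rowCounters colCounters fullCounters counters : List Counter
  rowCounters  = applyUpTo longRows (suc m)
  colCounters  = applyUpTo longCols (suc n)
  fullCounters = fullRows ∷ fullCols ∷ []
  counters     = rowCounters ++ colCounters ++ fullCounters

  totalCap-counters : totalCap counters ≡ 2 * suc m * suc n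
  totalCap-counters = trans
    (trans (totalCap-++ rowCounters _) (cong₂ _+_ (totalCap-applyUpTo longRows n (λ _ → refl) (suc m))
      (trans (totalCap-++ colCounters _) (cong (_+ totalCap fullCounters)
        (totalCap-applyUpTo longCols m (λ _ → refl) (suc n))))))
    (arith m n)
    where
    arith : ∀ m n → suc m * n + (suc n * m + (suc n + (suc m + 0))) ≡ 2 * suc m * suc n
    arith = solve-∀

  advances : ∀ t → ¬ Full (U (3 + t)) → ¬ ¬ Any (Advances t) counters
  advances t ¬full idle =
    newPoint t (¬full ∘ fullLater (m≤n+m t 3)) λ ((i , j) , ¬Ux , out) →
    exactCount (row (U t) j) (suc m) λ where
      (inj₁ long) → idle (Any.++⁺ʳ rowCounters (Any.++⁺ʳ colCounters (here
        -- Already having `suc n` full rows would fill the plane one step later.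
        ( ¬full ∘ fullLater (m≤n+m (suc t) 2) ∘ fullRows⇒full t
        , j , (λ full → ¬Ux (full i)) , longRow t j long))))
      (inj₂ (r , r<m , row≥r , row≱1+r)) → exactCount (col (U t) i) (suc n) λ where
        (inj₁ long) → idle (Any.++⁺ʳ rowCounters (Any.++⁺ʳ colCounters (there (here
          ( ¬full ∘ fullLater (m≤n+m (suc t) 2) ∘ fullCols⇒full t
          , i , (λ full → ¬Ux (full j)) , longCol t i long)))))
        (inj₂ (c , c<n , col≥c , col≱1+c)) →
          ¬¬-excluded-middle {A = Saturated t (longRows r)} λ where
            (no unsat) → idle (Any.++⁺ˡ (Any.applyUpTo⁺ longRows
              (unsat , j , row≱1+r , AtLeast-suc inj₁ ¬Ux (occupy t (i , j) out) row≥r) r<m))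
            (yes rows) → ¬¬-excluded-middle {A = Saturated t (longCols c)} λ where
              (no unsat) → idle (Any.++⁺ʳ rowCounters (Any.++⁺ˡ (Any.applyUpTo⁺ longCols
                (unsat , i , col≱1+c , AtLeast-suc inj₁ ¬Ux (occupy t (i , j) out) col≥c) c<n)))
              -- Row `j` has exactly `r` points, so it differs from the `n` rows with at least
              -- `suc r`; likewise for column `i`. The crossings are occupied at `1 + t`, the plane
              -- at `3 + t`.
              (yes cols) → ¬full (rectangle⇒full (suc t)
                (AtLeast-suc (AtLeast-≤ (n≤1+n r)) row≱1+r row≥r rows)
                (AtLeast-suc (AtLeast-≤ (n≤1+n c)) col≱1+c col≥c cols)
                (crossing t (i , j) out row≱1+r col≱1+c))
    where
    fullLater : ∀ {s} → s ≤ 3 + t → Full (U s) → Full (U (3 + t))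
    fullLater s≤ full x = Tpow-≤ I A s≤ x (full x)

  full : Full (U (3 + totalCap counters))
  full x = decidable-stable (Tpow? I A spans (3 + totalCap counters) x) λ ¬Ux →
    -- With `x` still empty, the plane is not full at `3 + t` for any `t` up to the total cap, so no
    -- such `t` is idle.
    someIdle counters λ t t≤cap → advances t λ full →
      ¬Ux (Tpow-≤ I A (+-monoʳ-≤ 3 t≤cap) x (full x))

theorem1p1 : (m n : ℕ) → 1 ≤ m → 1 ≤ n →
    (I : Index) → Positive I → Zset I ⊆ R m n →
    (A : Subset) → Finite A → Spans I A →
    ∃ λ t → 1 ≤ t × t ≤ 2 * m * n + 5 × Full (Tpow I t A)
theorem1p1 (suc m) (suc n) (s≤s _) (s≤s _) I pos Z⊆R A _ spans =
  3 + totalCap counters , s≤s z≤n , bound , full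
  where
  open Spanning {m} {n} I (index-bounds I pos Z⊆R) A spans
  bound : 3 + totalCap counters ≤ 2 * suc m * suc n + 5
  bound = begin
    3 + totalCap counters   ≡⟨ cong (3 +_) totalCap-counters ⟩
    3 + 2 * suc m * suc n   ≡⟨ +-comm 3 (2 * suc m * suc n) ⟩
    2 * suc m * suc n + 3   ≤⟨ +-monoʳ-≤ (2 * suc m * suc n) (m≤m+n 3 2) ⟩
    2 * suc m * suc n + 5   ∎
    where open ≤-Reasoning
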